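{- Let $n\ge 3$, $k\ge 1$ and $p\in\{0,1,2\}$. Then \[ \Gamma_{\rm S}(C_n,C_{3k+p})= \begin{cases} kn, & p=0,\\ kn+\lceil n/3\rceil, & p=1,\\ (k+1)n, & p=2. \end{cases} \]
   Context: $C_m$ denotes the cycle on $m$ vertices; $\gamma$ denotes the domination number. For graphs $G,H$ and a function $f\colon V(G)\to V(H)$, the Sierpiński product $G\otimes_f H$ is the graph with vertex set $V(G)\times V(H)$ and edges of two types: (type 1) $(g,h)(g,h')$ for every $g\in V(G)$ and every edge $hh'\in E(H)$; (type 2) $(g,f(g'))(g',f(g))$ for every edge $gg'\in E(G)$. The upper Sierpiński domination number is $\Gamma_{\rm S}(G,H)=\max_{f}\gamma(G\otimes_f H)$ over all functions $f\colon V(G)\to V(H)$. -}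

module Defs where

open import Data.Fin using (Fin; zero; suc; toℕ)
open import Data.Fin.Properties using (*↔×; all?; any?; inj⇒≟) renaming (_≟_ to _≟ᶠ_)
open import Data.Fin.Subset using (Subset; _∈_; ∣_∣; ⊤)
open import Data.Fin.Subset.Properties using (_∈?_; anySubset?; ∈⊤)
open import Data.Nat using (ℕ; zero; suc; _+_; _*_; _≤_; z≤n; s≤s; _≟_)
open import Data.Nat.DivMod using (_/_)
open import Data.Product using (∃; _×_; _,_; proj₁; proj₂)
open import Data.Product.Function.NonDependent.Propositional using (_×-↔_)
open import Data.Sum using (_⊎_; inj₁; inj₂; swap)
open import Function using (_∘_; _∘′_; _↔_; Inverse)
open import Function.Construct.Composition using (_↔-∘_)
open import Function.Construct.Identity using (↔-id)
open import Function.Construct.Symmetry using (↔-sym)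
open import Function.Properties.Inverse using (↔⇒↣)
open import Level using (0ℓ)
open import Relation.Binary using (Rel; Symmetric; Irreflexive; Decidable; DecidableEquality)
open import Relation.Binary.PropositionalEquality using (_≡_; _≢_; refl; sym; cong; subst)
open import Relation.Nullary using (Dec; yes; no; contradiction)
open import Relation.Nullary.Decidable using (map′; _×-dec_; _⊎-dec_; ¬?)
import Relation.Unary as U

-- Finite simple graphs.  The enumeration of the vertices serves to count
-- vertex sets, which are represented by Data.Fin.Subset.

record Graph : Set₁ where
  field
    V       : Set
    order   : ℕ
    enum    : V ↔ Fin order
    Adj     : Rel V 0ℓ
    adj?    : Decidable Adj
    symm    : Symmetric Adj
    irrefl  : Irreflexive _≡_ Adj

  index : V → Fin order
  index = Inverse.to enum

  vertex : Fin order → V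
  vertex = Inverse.from enum

  _≟V_ : DecidableEquality V
  _≟V_ = inj⇒≟ (↔⇒↣ enum)

open Graph

Dominating : (G : Graph) → Subset (order G) → Set
Dominating G D = ∀ v → index G v ∈ D ⊎ ∃ λ u → index G u ∈ D × Adj G u v

IsMinimum : (ℕ → Set) → ℕ → Set
IsMinimum P m = P m × (∀ j → P j → m ≤ j)

least : ∀ {P : ℕ → Set} → U.Decidable P → ∀ n → P n → ∃ (IsMinimum P)
least P? zero    p = zero , p , λ _ _ → z≤n
least P? (suc n) p with P? zero
... | yes p₀ = zero , p₀ , λ _ _ → z≤n
... | no ¬p₀ with least (P? ∘ suc) n p
...   | m , pm , m≤ = suc m , pm , λ where
          zero    p₀ → contradiction p₀ ¬p₀
          (suc j) pj → s≤s (m≤ j pj)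

module _ (G : Graph) where

  HasDominatingSetOfSize : ℕ → Set
  HasDominatingSetOfSize s = ∃ λ D → Dominating G D × ∣ D ∣ ≡ s

  private
    vertex-index : ∀ v → vertex G (index G v) ≡ v
    vertex-index v = Inverse.inverseʳ (enum G) refl

  ∀V? : ∀ {P : V G → Set} → U.Decidable P → Dec (∀ v → P v)
  ∀V? {P} P? = map′ (λ h v → subst P (vertex-index v) (h (index G v)))
                    (_∘ vertex G) (all? (P? ∘ vertex G))

  ∃V? : ∀ {P : V G → Set} → U.Decidable P → Dec (∃ P)
  ∃V? {P} P? = map′ (λ (i , p) → vertex G i , p)
                    (λ (v , p) → index G v , subst P (sym (vertex-index v)) p)
                    (any? (P? ∘ vertex G))

  dominating? : U.Decidable (Dominating G)
  dominating? D = ∀V? λ v →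
    (index G v ∈? D) ⊎-dec ∃V? (λ u → (index G u ∈? D) ×-dec adj? G u v)

  -- The witness that some size occurs is the full vertex set; by
  -- γ-isMinimum the value does not depend on it.
  domination : ∃ (IsMinimum HasDominatingSetOfSize)
  domination = least (λ s → anySubset? (λ D → dominating? D ×-dec (∣ D ∣ ≟ s)))
                     _ (⊤ , (λ _ → inj₁ ∈⊤) , refl)

  γ : ℕ
  γ = proj₁ domination

  γ-isMinimum : IsMinimum HasDominatingSetOfSize γ
  γ-isMinimum = proj₂ domination

-- Adjacency in G ⊗_f H: an unordered type-2 edge gg' contributes both
-- orientations, since Adj G is symmetric.
data SierpińskiAdj (G H : Graph) (f : V G → V H) : Rel (V G × V H) 0ℓ where
  type₁ : ∀ {g h h′} → Adj H h h′ → SierpińskiAdj G H f (g , h) (g , h′)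
  type₂ : ∀ {g g′} → Adj G g g′ → SierpińskiAdj G H f (g , f g′) (g′ , f g)

sierpińskiProduct : (G H : Graph) → (V G → V H) → Graph
sierpińskiProduct G H f = record
  { V      = V G × V H
  ; order  = order G * order H
  ; enum   = ↔-sym *↔× ↔-∘ (enum G ×-↔ enum H)
  ; Adj    = SierpińskiAdj G H f
  ; adj?   = dec
  ; symm   = λ where
      (type₁ e) → type₁ (symm H e)
      (type₂ e) → type₂ (symm G e)
  ; irrefl = λ p e → irr e p
  }
  where
  irr : ∀ {x y} → SierpińskiAdj G H f x y → x ≢ y
  irr (type₁ e) p = irrefl H (cong proj₂ p) e
  irr (type₂ e) p = irrefl G (cong proj₁ p) e

  Unfolded : Rel (V G × V H) 0ℓ
  Unfolded (g , h) (g′ , h′) =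
    (g ≡ g′ × Adj H h h′) ⊎ (Adj G g g′ × h ≡ f g′ × h′ ≡ f g)

  fold : ∀ {x y} → Unfolded x y → SierpińskiAdj G H f x y
  fold (inj₁ (refl , e))        = type₁ e
  fold (inj₂ (e , refl , refl)) = type₂ e

  unfold : ∀ {x y} → SierpińskiAdj G H f x y → Unfolded x y
  unfold (type₁ e) = inj₁ (refl , e)
  unfold (type₂ e) = inj₂ (e , refl , refl)

  dec : Decidable (SierpińskiAdj G H f)
  dec (g , h) (g′ , h′) = map′ fold unfold
    (((_≟V_ G g g′) ×-dec adj? H h h′)
      ⊎-dec (adj? G g g′ ×-dec (_≟V_ H h (f g′) ×-dec _≟V_ H h′ (f g))))

IsMaximumOf : {A : Set} → (A → ℕ) → ℕ → Set
IsMaximumOf F m = (∃ λ a → F a ≡ m) × (∀ a → F a ≤ m)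

-- "Γ_S(G,H) = m".  A relation rather than a function, because the maximum
-- does not exist when there is no map V(G) → V(H).
Γₛ[_,_]≔_ : Graph → Graph → ℕ → Set
Γₛ[ G , H ]≔ m = IsMaximumOf (λ (f : V G → V H) → γ (sierpińskiProduct G H f)) m

-- j = i + 1 modulo n
Next : ∀ {n} → Rel (Fin n) 0ℓ
Next {n} i j = toℕ j ≡ suc (toℕ i) ⊎ (suc (toℕ i) ≡ n × toℕ j ≡ 0)

-- The cycle C_n for n ≥ 3, where the condition i ≢ j is automatic; it only
-- removes the loop that n = 1 would otherwise have.
C : ℕ → Graph
C n = record
  { V      = Fin n
  ; order  = n
  ; enum   = ↔-id (Fin n)
  ; Adj    = λ i j → i ≢ j × (Next i j ⊎ Next j i)
  ; adj?   = λ i j → ¬? (i ≟ᶠ j) ×-dec (next? i j ⊎-dec next? j i)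
  ; symm   = λ (i≢j , e) → (i≢j ∘′ sym) , swap e
  ; irrefl = λ i≡j (i≢j , _) → i≢j i≡j
  }
  where
  next? : Decidable (Next {n})
  next? i j = (toℕ j ≟ suc (toℕ i)) ⊎-dec ((suc (toℕ i) ≟ n) ×-dec (toℕ j ≟ 0))

⌈_/3⌉ : ℕ → ℕ
⌈ n /3⌉ = (n + 2) / 3

{-# OPTIONS --safe #-}
-- In C_m a set D dominates at most 3|D| vertices.  For constant f the copies
-- of C_m meet only in one vertex c each, so the slice D_g of a dominating set
-- dominates all vertices of its copy but possibly c: 3|D_g| ≥ m - 1.  This is
-- the lower bound for p = 0, 2.  For p = 1, |D_g| = k forces c to be
-- dominated from a neighbouring copy whose slice contains c and hence has more
-- than k elements; thus the copies with more than k elements dominate C_n.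
--
-- Upper bounds hold for every f: taking every third vertex gives ⌈m/3⌉ per
-- copy.  For m = 3k + 1, any two vertices lie in a common dominating set of
-- size k + 1, and k vertices suffice to dominate all but one arbitrary vertex.
-- Use the former, through both connectors, in every third copy, and the latter
-- in the others, leaving out the vertex joined to such a copy.

module Submission where

open import Defs
open import Data.Nat using (ℕ; suc; _+_; _*_; _≤_)
open import Data.Product using (_×_)
open import Relation.Binary.PropositionalEquality using (_≡_)

open import Data.Bool using (Bool; true; false)
open import Data.Bool.Properties using (T-≡)
open import Data.Fin using (Fin; zero; suc; toℕ; fromℕ; inject₁; _↑ˡ_; _↑ʳ_; combine; remQuot)
open import Data.Fin.Induction using (<-weakInduction)
open import Data.Fin.Permutation using (permutation)
open import Data.Fin.Properties using (toℕ-fromℕ; toℕ-inject₁; toℕ-injective; toℕ<n; remQuot-combine) renaming (_≟_ to _≟ᶠ_)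
open import Data.Fin.Relation.Unary.Top using (view; ‵fromℕ; ‵inject₁; view-fromℕ; view-inject₁)
open import Data.Fin.Subset using (∣_∣)
open import Data.Nat using (zero; _<_; _<ᵇ_; z≤n; s≤s)
open import Data.Nat.DivMod using (_/_; m/n≡1+[m∸n]/n; m/n*n≤m; m<n*o⇒m/o<n; +-distrib-/-∣ˡ; m*n/n≡m)
open import Data.Nat.Divisibility using (m∣m*n)
open import Data.Nat.Properties
open import Data.Product using (∃; _,_; proj₁; proj₂)
open import Data.Sum using (_⊎_; inj₁; inj₂)
open import Data.Vec using (tabulate; lookup)
open import Data.Vec.Properties using (lookup∘tabulate; tabulate∘lookup; lookup⇒[]=; []=⇒lookup)
open import Function using (_∘_; Inverse; Equivalence)
open import Relation.Binary.PropositionalEquality using (_≢_; refl; sym; trans; cong; cong₂; subst; module ≡-Reasoning)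
open import Relation.Nullary using (Dec; yes; no; contradiction)
open import Data.Nat.Tactic.RingSolver using (solve-∀)

open import Algebra.Properties.CommutativeMonoid.Sum +-0-commutativeMonoid
  using (sum; sum-cong-≗; ∑-distrib-+; sum-permute)

open Graph

-- Sums and cardinalities

sum-mono-≤ : ∀ {n} {s t : Fin n → ℕ} → (∀ i → s i ≤ t i) → sum s ≤ sum t
sum-mono-≤ {zero}  s≤t = z≤n
sum-mono-≤ {suc n} s≤t = +-mono-≤ (s≤t zero) (sum-mono-≤ (s≤t ∘ suc))

sum-const : ∀ n c → sum {n} (λ _ → c) ≡ c * n
sum-const zero    c = sym (*-zeroʳ c)
sum-const (suc n) c = trans (cong (c +_) (sum-const n c)) (sym (*-suc c n))

sum-↑ : ∀ m {n} (s : Fin (m + n) → ℕ) →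
        sum s ≡ sum (s ∘ (_↑ˡ n)) + sum (s ∘ (m ↑ʳ_))
sum-↑ zero    s = refl
sum-↑ (suc m) s = trans (cong (s zero +_) (sum-↑ m (s ∘ suc))) (sym (+-assoc (s zero) _ _))

sum-combine : ∀ n {m} (s : Fin (n * m) → ℕ) →
              sum s ≡ sum (λ (i : Fin n) → sum (λ (j : Fin m) → s (combine i j)))
sum-combine zero        s = refl
sum-combine (suc n) {m} s =
  trans (sum-↑ m s) (cong (sum (s ∘ (_↑ˡ n * m)) +_) (sum-combine n (s ∘ (m ↑ʳ_))))

𝟙 : Bool → ℕ
𝟙 true  = 1
𝟙 false = 0

𝟙-≤ : ∀ b {x} → (b ≡ true → 1 ≤ x) → 𝟙 b ≤ x
𝟙-≤ true  h = h refl
𝟙-≤ false h = z≤n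

𝟙-true : ∀ {b} → b ≡ true → 1 ≤ 𝟙 b
𝟙-true refl = ≤-refl

-- Splits a slice size into the baseline `k` and an indicator of excess; summing the indicators
-- counts the larger slices.
k+𝟙[k<x]≤x : ∀ {k x} → k ≤ x → k + 𝟙 (k <ᵇ x) ≤ x
k+𝟙[k<x]≤x {x = zero}  z≤n       = z≤n
k+𝟙[k<x]≤x {x = suc x} z≤n       = s≤s z≤n
k+𝟙[k<x]≤x             (s≤s k≤x) = s≤s (k+𝟙[k<x]≤x k≤x)

card : ∀ {n} → (Fin n → Bool) → ℕ
card D = sum (𝟙 ∘ D)

card-univ : ∀ n → card {n} (λ _ → true) ≡ n
card-univ n = trans (sum-const n 1) (*-identityˡ n)

∣tabulate∣ : ∀ {n} (D : Fin n → Bool) → ∣ tabulate D ∣ ≡ card D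
∣tabulate∣ {zero}  D = refl
∣tabulate∣ {suc n} D with D zero
... | true  = cong suc (∣tabulate∣ (D ∘ suc))
... | false = ∣tabulate∣ (D ∘ suc)

-- The domination number in terms of Boolean predicates on the vertices

-- A predicate on pairs restricts to a single copy by fixing the first coordinate, which a subset of
-- `Fin (order G)` does not.
DominatingPred : (G : Graph) → (V G → Bool) → Set
DominatingPred G D = ∀ v → D v ≡ true ⊎ ∃ λ u → D u ≡ true × Adj G u v

module _ (G : Graph) where

  γ≤card : ∀ {D} → DominatingPred G D → γ G ≤ card (D ∘ vertex G)
  γ≤card {D} dom =
    ≤-trans (proj₂ (γ-isMinimum G) _ (tabulate (D ∘ vertex G) , dominating , refl))
            (≤-reflexive (∣tabulate∣ (D ∘ vertex G)))
    where
    member : ∀ v → D v ≡ true → lookup (tabulate (D ∘ vertex G)) (index G v) ≡ true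
    member v Dv = trans (lookup∘tabulate (D ∘ vertex G) (index G v))
                        (trans (cong D (Inverse.inverseʳ (enum G) refl)) Dv)

    dominating : Dominating G (tabulate (D ∘ vertex G))
    dominating v with dom v
    ... | inj₁ Dv             = inj₁ (lookup⇒[]= _ _ (member v Dv))
    ... | inj₂ (u , Du , u∼v) = inj₂ (u , lookup⇒[]= _ _ (member u Du) , u∼v)

  ≤γ : ∀ {s} → (∀ D → DominatingPred G D → s ≤ card (D ∘ vertex G)) → s ≤ γ G
  ≤γ {s} bound with proj₁ (γ-isMinimum G)
  ... | S , dominating , ∣S∣≡γ = ≤-trans (bound (lookup S ∘ index G) dom) (≤-reflexive card≡γ)
    where
    dom : DominatingPred G (lookup S ∘ index G)
    dom v with dominating v
    ... | inj₁ v∈S             = inj₁ ([]=⇒lookup v∈S)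
    ... | inj₂ (u , u∈S , u∼v) = inj₂ (u , []=⇒lookup u∈S , u∼v)

    card≡γ : card (lookup S ∘ index G ∘ vertex G) ≡ γ G
    card≡γ = begin
      card (lookup S ∘ index G ∘ vertex G)
        ≡⟨ sum-cong-≗ {x = λ i → 𝟙 (lookup S (index G (vertex G i)))} {y = 𝟙 ∘ lookup S}
             (λ i → cong (𝟙 ∘ lookup S) (Inverse.inverseˡ (enum G) refl)) ⟩
      card (lookup S)             ≡⟨ ∣tabulate∣ (lookup S) ⟨
      ∣ tabulate (lookup S) ∣     ≡⟨ cong ∣_∣ (tabulate∘lookup S) ⟩
      ∣ S ∣                       ≡⟨ ∣S∣≡γ ⟩
      γ G                         ∎
      where open ≡-Reasoning

-- Cyclic successor and predecessor

next : ∀ {m} → Fin m → Fin m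
next {suc m} i with view i
... | ‵fromℕ     = zero
... | ‵inject₁ j = suc j

prev : ∀ {m} → Fin m → Fin m
prev {suc m} zero    = fromℕ m
prev {suc m} (suc i) = inject₁ i

next-fromℕ : ∀ m → next (fromℕ m) ≡ zero
next-fromℕ m rewrite view-fromℕ m = refl

next-inject₁ : ∀ {m} (i : Fin m) → next (inject₁ i) ≡ suc i
next-inject₁ i rewrite view-inject₁ i = refl

next-prev : ∀ {m} (i : Fin m) → next (prev i) ≡ i
next-prev {suc m} zero    = next-fromℕ m
next-prev {suc m} (suc i) = next-inject₁ i

prev-next : ∀ {m} (i : Fin m) → prev (next i) ≡ i
prev-next {suc m} i with view i
... | ‵fromℕ     = refl
... | ‵inject₁ j = refl

Next-next : ∀ {m} (i : Fin m) → Next i (next i)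
Next-next {suc m} i with view i
... | ‵fromℕ     = inj₂ (cong suc (toℕ-fromℕ m) , refl)
... | ‵inject₁ j = inj₁ (cong suc (sym (toℕ-inject₁ j)))

Next⇒next : ∀ {m} {i j : Fin m} → Next i j → j ≡ next i
Next⇒next {suc m} {i} {j} Nij = toℕ-injective (functional Nij (Next-next i))
  where
  functional : ∀ {j j′ : Fin (suc m)} → Next i j → Next i j′ → toℕ j ≡ toℕ j′
  functional         (inj₁ p)       (inj₁ q)        = trans p (sym q)
  -- In a mixed pair, the successor that does not wrap would have the value `suc m`, out of range.
  functional {j}     (inj₁ p)       (inj₂ (q , _))  = contradiction (trans p q) (<⇒≢ (toℕ<n j))
  functional {j′ = j′} (inj₂ (p , _)) (inj₁ q)      = contradiction (trans q p) (<⇒≢ (toℕ<n j′))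
  functional         (inj₂ (_ , p)) (inj₂ (_ , q))  = trans p (sym q)

next≢ : ∀ {m} → 2 ≤ m → (i : Fin m) → i ≢ next i
next≢ 2≤m i eq with Next-next i
... | inj₁ p       = 1+n≢n (trans (sym p) (cong toℕ (sym eq)))
... | inj₂ (p , q) = <⇒≢ 2≤m (trans (cong suc (sym (trans (cong toℕ eq) q))) p)

adj-next : ∀ {m} → 2 ≤ m → (i : Fin m) → Adj (C m) i (next i)
adj-next 2≤m i = next≢ 2≤m i , inj₁ (Next-next i)

adj-prev : ∀ {m} → 2 ≤ m → (i : Fin m) → Adj (C m) i (prev i)
adj-prev {m} 2≤m i =
  symm (C m) (subst (Adj (C m) (prev i)) (next-prev i) (adj-next 2≤m (prev i)))

adj⇒ : ∀ {m} {i j : Fin m} → Adj (C m) i j → i ≡ next j ⊎ i ≡ prev j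
adj⇒ (_ , inj₁ Nij) = inj₂ (trans (sym (prev-next _)) (cong prev (sym (Next⇒next Nij))))
adj⇒ (_ , inj₂ Nji) = inj₁ (Next⇒next Nji)

-- The closed neighbourhood of `v` meets `D`. Written with the bijections `next` and `prev`, it can
-- be counted and rotated without adjacency proofs.
Near : ∀ {m} → (Fin m → Bool) → Fin m → Set
Near D v = D v ≡ true ⊎ D (next v) ≡ true ⊎ D (prev v) ≡ true

near : ∀ {m} {D : Fin m → Bool} {u v} → D u ≡ true → Adj (C m) u v → Near D v
near Du u∼v with adj⇒ u∼v
... | inj₁ refl = inj₂ (inj₁ Du)
... | inj₂ refl = inj₂ (inj₂ Du)

card-prev : ∀ {m} (D : Fin m → Bool) → card (D ∘ prev) ≡ card D
card-prev D = sym (sum-permute (𝟙 ∘ D) (permutation prev next prev-next next-prev))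

card-next : ∀ {m} (D : Fin m → Bool) → card (D ∘ next) ≡ card D
card-next D = sym (sum-permute (𝟙 ∘ D) (permutation next prev next-prev prev-next))

-- Each `v` in `S` is charged to a member of `D` at `v`, `next v` or `prev v`. Since `next` and
-- `prev` are permutations, each of the three sums equals `card D`.
card-near : ∀ {m} (S D : Fin m → Bool) → (∀ v → S v ≡ true → Near D v) → card S ≤ 3 * card D
card-near S D S⊆N[D] = begin
  card S
    ≤⟨ sum-mono-≤ (λ v → 𝟙-≤ (S v) (count v ∘ S⊆N[D] v)) ⟩
  sum (λ v → 𝟙 (D v) + (𝟙 (D (next v)) + 𝟙 (D (prev v))))
    ≡⟨ ∑-distrib-+ (𝟙 ∘ D) _ ⟩
  card D + sum (λ v → 𝟙 (D (next v)) + 𝟙 (D (prev v)))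
    ≡⟨ cong (card D +_) (∑-distrib-+ (𝟙 ∘ D ∘ next) _) ⟩
  card D + (card (D ∘ next) + card (D ∘ prev))
    ≡⟨ cong (card D +_) (cong₂ _+_ (card-next D) (trans (card-prev D) (sym (+-identityʳ _)))) ⟩
  3 * card D ∎
  where
  open ≤-Reasoning
  count : ∀ v → Near D v → 1 ≤ 𝟙 (D v) + (𝟙 (D (next v)) + 𝟙 (D (prev v)))
  count v (inj₁ p)        = m≤n⇒m≤n+o _ (𝟙-true p)
  count v (inj₂ (inj₁ p)) = m≤n⇒m≤o+n (𝟙 (D v)) (m≤n⇒m≤n+o _ (𝟙-true p))
  count v (inj₂ (inj₂ p)) = m≤n⇒m≤o+n (𝟙 (D v)) (m≤n⇒m≤o+n (𝟙 (D (next v))) (𝟙-true p))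

-- Sierpiński products of cycles

γ⊗ : ∀ {n m} → (Fin n → Fin m) → ℕ
γ⊗ {n} {m} f = γ (sierpińskiProduct (C n) (C m) f)

module _ {n m : ℕ} (f : Fin n → Fin m) where

  private
    P = sierpińskiProduct (C n) (C m) f

  card-slices : (D : V P → Bool) → card (D ∘ vertex P) ≡ sum (λ g → card (λ h → D (g , h)))
  card-slices D = trans (sum-combine n (𝟙 ∘ D ∘ remQuot m))
    (sum-cong-≗ (λ g → sum-cong-≗ (λ h → cong (𝟙 ∘ D) (remQuot-combine g h))))

  -- The second alternative is the type-2 edge from `(g′ , f g)` to `(g , f g′)`.
  γ≤slices : 2 ≤ n → 2 ≤ m → (D : Fin n → Fin m → Bool) →
    (∀ g h → Near (D g) h ⊎ ∃ λ g′ → Adj (C n) g′ g × D g′ (f g) ≡ true × h ≡ f g′) →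
    γ P ≤ sum (card ∘ D)
  γ≤slices 2≤n 2≤m D dom =
    ≤-trans (γ≤card P dominating) (≤-reflexive (card-slices (λ (g , h) → D g h)))
    where
    dominating : DominatingPred P (λ (g , h) → D g h)
    dominating (g , h) with dom g h
    ... | inj₁ (inj₁ p)        = inj₁ p
    ... | inj₁ (inj₂ (inj₁ p)) = inj₂ ((g , next h) , p , type₁ (symm (C m) (adj-next 2≤m h)))
    ... | inj₁ (inj₂ (inj₂ p)) = inj₂ ((g , prev h) , p , type₁ (symm (C m) (adj-prev 2≤m h)))
    ... | inj₂ (g′ , g′∼g , p , refl) = inj₂ ((g′ , f g) , p , type₂ g′∼g)

-- When f is constant, a copy is joined to the others through a single vertex, zero.
module _ {n m : ℕ} {s : ℕ} where

  private
    P = sierpińskiProduct (C n) (C (suc m)) (λ _ → zero)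

  slices≤γ :
    ((D : Fin n → Fin (suc m) → Bool) →
     (∀ g → m ≤ 3 * card (D g)) →
     (∀ g → Near (D g) zero → suc m ≤ 3 * card (D g)) →
     (∀ g → Near (D g) zero ⊎ ∃ λ g′ → Adj (C n) g′ g × D g′ zero ≡ true) →
     s ≤ sum (card ∘ D)) →
    s ≤ γ P
  slices≤γ bound = ≤γ P λ D dom → ≤-trans
    (bound (λ g h → D (g , h)) (size D dom) (size₀ D dom) (at-zero D dom))
    (≤-reflexive (sym (card-slices (λ _ → zero) D)))
    where
    module _ (D : V P → Bool) (dom : DominatingPred P D) where

      inside : ∀ g h → h ≢ zero → Near (λ h → D (g , h)) h
      inside g h h≢0 with dom (g , h)
      ... | inj₁ p                  = inj₁ p
      ... | inj₂ (_ , p , type₁ e)  = near p e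
      -- For the constant map every type-2 edge ends at second coordinate `zero`.
      ... | inj₂ (_ , p , type₂ e)  = contradiction refl h≢0

      at-zero : ∀ g → Near (λ h → D (g , h)) zero ⊎ ∃ λ g′ → Adj (C n) g′ g × D (g′ , zero) ≡ true
      at-zero g with dom (g , zero)
      ... | inj₁ p                  = inj₁ (inj₁ p)
      ... | inj₂ (_ , p , type₁ e)  = inj₁ (near p e)
      ... | inj₂ (_ , p , type₂ e)  = inj₂ (_ , e , p)

      size₀ : ∀ g → Near (λ h → D (g , h)) zero → suc m ≤ 3 * card (λ h → D (g , h))
      size₀ g near₀ = ≤-trans (≤-reflexive (sym (card-univ (suc m))))
        (card-near (λ _ → true) (λ h → D (g , h)) λ where
          zero    _ → near₀
          (suc h) _ → inside g (suc h) λ ())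

      size : ∀ g → m ≤ 3 * card (λ h → D (g , h))
      size g = ≤-trans (≤-reflexive (sym (card-univ m)))
        -- The summand of `nonzero` at `zero` is 0, so `card nonzero` reduces to the cardinality of
        -- all of `Fin m`.
        (card-near nonzero (λ h → D (g , h)) λ where
          (suc h) _ → inside g (suc h) λ ())
        where
        nonzero : Fin (suc m) → Bool
        nonzero zero    = false
        nonzero (suc _) = true

-- Small dominating sets of cycles

-- Patterns live on `ℕ`, so that recursion in steps of three and cutting at any length need no casts
-- between `Fin` types.
append : ℕ → (ℕ → Bool) → (ℕ → Bool) → ℕ → Bool
append zero    F G i       = G i
append (suc d) F G zero    = F 0
append (suc d) F G (suc i) = append d (F ∘ suc) G i

append-self : ∀ d F G → append d F G d ≡ G 0
append-self zero    F G = refl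
append-self (suc d) F G = append-self d (F ∘ suc) G

card-append : ∀ d e F G → card {d + e} (append d F G ∘ toℕ) ≡ card {d} (F ∘ toℕ) + card {e} (G ∘ toℕ)
card-append zero    e F G = refl
card-append (suc d) e F G =
  trans (cong (𝟙 (F 0) +_) (card-append d e (F ∘ suc) G)) (sym (+-assoc (𝟙 (F 0)) _ _))

multiple₃ : ℕ → Bool
multiple₃ 0 = true
multiple₃ 1 = false
multiple₃ 2 = false
multiple₃ (suc (suc (suc i))) = multiple₃ i

⌈3+n/3⌉ : ∀ n → ⌈ 3 + n /3⌉ ≡ suc ⌈ n /3⌉
⌈3+n/3⌉ n = m/n≡1+[m∸n]/n {3 + n + 2} {3} (s≤s (s≤s (s≤s z≤n)))

⌈3k+p/3⌉ : ∀ k p → ⌈ 3 * k + p /3⌉ ≡ k + ⌈ p /3⌉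
⌈3k+p/3⌉ k p = begin
  (3 * k + p + 2) / 3         ≡⟨ cong (_/ 3) (+-assoc (3 * k) p 2) ⟩
  (3 * k + (p + 2)) / 3       ≡⟨ +-distrib-/-∣ˡ (p + 2) (m∣m*n k) ⟩
  3 * k / 3 + (p + 2) / 3     ≡⟨ cong (_+ ⌈ p /3⌉) (trans (cong (_/ 3) (*-comm 3 k)) (m*n/n≡m k 3)) ⟩
  k + (p + 2) / 3             ∎
  where
  open ≡-Reasoning

⌈n/3⌉-least : ∀ {n c} → n ≤ 3 * c → ⌈ n /3⌉ ≤ c
⌈n/3⌉-least {n} {c} n≤3c = m<1+n⇒m≤n (m<n*o⇒m/o<n (begin-strict
  n + 2        <⟨ +-mono-≤-< n≤3c (n<1+n 2) ⟩
  3 * c + 3    ≡⟨ +-comm (3 * c) 3 ⟩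
  3 + 3 * c    ≡⟨ cong (3 +_) (*-comm 3 c) ⟩
  suc c * 3    ∎))
  where open ≤-Reasoning

card-multiple₃ : ∀ n → card {n} (multiple₃ ∘ toℕ) ≡ ⌈ n /3⌉
card-multiple₃ 0 = refl
card-multiple₃ 1 = refl
card-multiple₃ 2 = refl
card-multiple₃ (suc (suc (suc n))) = trans (cong suc (card-multiple₃ n)) (sym (⌈3+n/3⌉ n))

-- Closed neighbourhoods in the one-way infinite path; giving the predecessor by an equation leaves
-- 0 without one.
PathNear : (ℕ → Bool) → ℕ → Set
PathNear F i = F i ≡ true ⊎ F (suc i) ≡ true ⊎ ∃ λ j → i ≡ suc j × F j ≡ true

pathNear-suc : ∀ {F i} → PathNear (F ∘ suc) i → PathNear F (suc i)
pathNear-suc (inj₁ p)                     = inj₁ p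
pathNear-suc (inj₂ (inj₁ p))              = inj₂ (inj₁ p)
pathNear-suc (inj₂ (inj₂ (j , refl , p))) = inj₂ (inj₂ (suc j , refl , p))

-- The multiples of 3 below d, followed by the numbers d, d + 3, d + 6, …
restart₃ : ℕ → ℕ → Bool
restart₃ d = append d multiple₃ multiple₃

restart₃-0 : ∀ d → restart₃ d 0 ≡ true
restart₃-0 zero    = refl
restart₃-0 (suc d) = refl

-- The pattern contains 0 and has gaps of at most 3: restarting at `d` can only shorten the gap
-- before `d`.
pathNear-restart₃ : ∀ d i → PathNear (restart₃ d) i
pathNear-restart₃ 0 0 = inj₁ refl
pathNear-restart₃ 0 1 = inj₂ (inj₂ (0 , refl , refl))
pathNear-restart₃ 0 2 = inj₂ (inj₁ refl)
pathNear-restart₃ 0 (suc (suc (suc i))) =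
  pathNear-suc (pathNear-suc (pathNear-suc (pathNear-restart₃ 0 i)))
pathNear-restart₃ 1 0 = inj₁ refl
pathNear-restart₃ 1 (suc i) = pathNear-suc (pathNear-restart₃ 0 i)
pathNear-restart₃ 2 0 = inj₁ refl
pathNear-restart₃ 2 1 = inj₂ (inj₁ refl)
pathNear-restart₃ 2 (suc (suc i)) = pathNear-suc (pathNear-suc (pathNear-restart₃ 0 i))
pathNear-restart₃ (suc (suc (suc d))) 0 = inj₁ refl
pathNear-restart₃ (suc (suc (suc d))) 1 = inj₂ (inj₂ (0 , refl , refl))
pathNear-restart₃ (suc (suc (suc d))) 2 = inj₂ (inj₁ (restart₃-0 d))
pathNear-restart₃ (suc (suc (suc d))) (suc (suc (suc i))) =
  pathNear-suc (pathNear-suc (pathNear-suc (pathNear-restart₃ d i)))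

-- Closing the path to a cycle changes only the successor of the last position, from `m` to 0;
-- `wrap` transfers membership there.
near-toℕ : ∀ {m} (F : ℕ → Bool) → (F m ≡ true → F 0 ≡ true) →
           (i : Fin m) → PathNear F (toℕ i) → Near (F ∘ toℕ) i
near-toℕ F wrap i (inj₁ p) = inj₁ p
near-toℕ F wrap i (inj₂ (inj₁ p)) with Next-next i
... | inj₁ q       = inj₂ (inj₁ (trans (cong F q) p))
... | inj₂ (q , r) = inj₂ (inj₁ (trans (cong F r) (wrap (trans (cong F (sym q)) p))))
near-toℕ F wrap (suc i) (inj₂ (inj₂ (_ , refl , p))) =
  inj₂ (inj₂ (trans (cong F (toℕ-inject₁ i)) p))

near-restart₃ : ∀ {m} d (i : Fin m) → Near (restart₃ d ∘ toℕ) i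
near-restart₃ d i =
  near-toℕ (restart₃ d) (λ _ → restart₃-0 d) i (pathNear-restart₃ d (toℕ i))

near-prev : ∀ {m} (D : Fin m → Bool) v → Near D (prev v) → Near (D ∘ prev) v
near-prev D v (inj₁ p)        = inj₁ p
near-prev D v (inj₂ (inj₁ p)) =
  inj₂ (inj₁ (trans (cong D (trans (prev-next v) (sym (next-prev v)))) p))
near-prev D v (inj₂ (inj₂ p)) = inj₂ (inj₂ p)

-- Allows a distinguished vertex to be rotated to `zero`.
next-induction : ∀ {m} (Q : Fin (suc m) → Set) → Q zero → (∀ i → Q i → Q (next i)) → ∀ i → Q i
next-induction Q Q₀ step =
  <-weakInduction Q Q₀ (λ i q → subst Q (next-inject₁ i) (step (inject₁ i) q))

-- Dominating sets of the cycle on 3k + 1 vertices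

module _ (k : ℕ) {m : ℕ} (m≡ : m ≡ 3 * k) where

  -- The rounding costs at most 2/3 twice, so the sum is at most (3k + 5)/3, which is less than k +
  -- 2.
  ⌈/3⌉+⌈/3⌉ : ∀ d e → d + e ≡ suc m → ⌈ d /3⌉ + ⌈ e /3⌉ ≤ suc k
  ⌈/3⌉+⌈/3⌉ d e d+e≡ = m<1+n⇒m≤n (*-cancelʳ-< 3 (⌈ d /3⌉ + ⌈ e /3⌉) (2 + k) (begin-strict
    (⌈ d /3⌉ + ⌈ e /3⌉) * 3     ≡⟨ *-distribʳ-+ 3 ⌈ d /3⌉ ⌈ e /3⌉ ⟩
    ⌈ d /3⌉ * 3 + ⌈ e /3⌉ * 3   ≤⟨ +-mono-≤ (m/n*n≤m (d + 2) 3) (m/n*n≤m (e + 2) 3) ⟩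
    (d + 2) + (e + 2)           ≡⟨ regroup d e ⟩
    (d + e) + 4                 ≡⟨ cong (_+ 4) (trans d+e≡ (cong suc (trans m≡ (*-comm 3 k)))) ⟩
    suc (k * 3) + 4             ≡⟨ +-comm (suc (k * 3)) 4 ⟩
    5 + k * 3                   <⟨ n<1+n _ ⟩
    (2 + k) * 3                 ∎))
    where
    open ≤-Reasoning
    regroup : ∀ d e → (d + 2) + (e + 2) ≡ (d + e) + 4
    regroup = solve-∀

  -- With `a` rotated to `zero`, cut the cycle before `zero` and before `b`. In each of the two arcs
  -- take every third vertex, beginning with its first.
  dominating-through : ∀ (a b : Fin (suc m)) → ∃ λ D →
    card D ≤ suc k × D a ≡ true × D b ≡ true × (∀ v → Near D v)
  dominating-through = next-induction _ base step
    where
    base : ∀ b → ∃ λ D → card D ≤ suc k × D zero ≡ true × D b ≡ true × (∀ v → Near D v)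
    base b with e , d+e≡ ← m≤n⇒∃[o]m+o≡n (<⇒≤ (toℕ<n b)) =
        restart₃ (toℕ b) ∘ toℕ
      , ≤-trans (≤-reflexive size) (⌈/3⌉+⌈/3⌉ (toℕ b) e d+e≡)
      , restart₃-0 (toℕ b)
      , append-self (toℕ b) multiple₃ multiple₃
      , near-restart₃ (toℕ b)
      where
      size : card {suc m} (restart₃ (toℕ b) ∘ toℕ) ≡ ⌈ toℕ b /3⌉ + ⌈ e /3⌉
      size = begin
        card {suc m} (restart₃ (toℕ b) ∘ toℕ)
          ≡⟨ cong (λ l → card {l} (restart₃ (toℕ b) ∘ toℕ)) d+e≡ ⟨
        card {toℕ b + e} (restart₃ (toℕ b) ∘ toℕ)
          ≡⟨ card-append (toℕ b) e multiple₃ multiple₃ ⟩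
        card {toℕ b} (multiple₃ ∘ toℕ) + card {e} (multiple₃ ∘ toℕ)
          ≡⟨ cong₂ _+_ (card-multiple₃ (toℕ b)) (card-multiple₃ e) ⟩
        ⌈ toℕ b /3⌉ + ⌈ e /3⌉ ∎
        where open ≡-Reasoning

    step : ∀ a →
      (∀ b → ∃ λ D → card D ≤ suc k × D a ≡ true × D b ≡ true × (∀ v → Near D v)) →
      ∀ b → ∃ λ D → card D ≤ suc k × D (next a) ≡ true × D b ≡ true × (∀ v → Near D v)
    -- Rotating by one turns a set through `a` and `prev b` into one through `next a` and `b`.
    step a ih b with D , size , Da , Db , dom ← ih (prev b) =
        D ∘ prev
      , ≤-trans (≤-reflexive (card-prev D)) size
      , trans (cong D (prev-next a)) Da
      , Db
      , λ v → near-prev D v (dom (prev v))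

  -- Without `a` the cycle is a path on 3k vertices; cut it into triples and take their middles. For
  -- `a` equal to `zero` these are 2, 5, 8, ...
  dominating-except : ∀ (a : Fin (suc m)) → ∃ λ D → card D ≤ k × (∀ v → v ≢ a → Near D v)
  dominating-except = next-induction _ base step
    where
    size : card {suc m} (multiple₃ ∘ suc ∘ toℕ) ≡ k
    -- Prefixing the pattern with position 0, which `multiple₃` contains, raises the count by one
    -- and gives a known count.
    size = suc-injective (begin
      card {2 + m} (multiple₃ ∘ toℕ)  ≡⟨ card-multiple₃ (2 + m) ⟩
      ⌈ 2 + m /3⌉                     ≡⟨ cong ⌈_/3⌉ (trans (+-comm 2 m) (cong (_+ 2) m≡)) ⟩
      ⌈ 3 * k + 2 /3⌉                 ≡⟨ ⌈3k+p/3⌉ k 2 ⟩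
      k + 1                           ≡⟨ +-comm k 1 ⟩
      suc k                           ∎)
      where open ≡-Reasoning

    multiple₃-3k+2 : ∀ k → multiple₃ (k * 3 + 2) ≡ false
    multiple₃-3k+2 zero    = refl
    multiple₃-3k+2 (suc k) = multiple₃-3k+2 k

    -- The position just past the last vertex is not in the pattern, so the wrapping condition of
    -- `near-toℕ` holds vacuously.
    no-wrap : multiple₃ (2 + m) ≡ false
    no-wrap = trans (cong multiple₃ (trans (+-comm 2 m) (cong (_+ 2) (trans m≡ (*-comm 3 k)))))
                    (multiple₃-3k+2 k)

    shifted : ∀ i → PathNear (multiple₃ ∘ suc) (suc i)
    shifted 0 = inj₂ (inj₁ refl)
    shifted 1 = inj₁ refl
    shifted 2 = inj₂ (inj₂ (2 , refl , refl))
    shifted (suc (suc (suc i))) = pathNear-suc (pathNear-suc (pathNear-suc (shifted i)))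

    base : ∃ λ D → card D ≤ k × (∀ v → v ≢ zero → Near D v)
    base = multiple₃ ∘ suc ∘ toℕ , ≤-reflexive size , λ where
      zero    v≢0 → contradiction refl v≢0
      (suc i) _   → near-toℕ (multiple₃ ∘ suc)
                      (λ p → contradiction (trans (sym p) no-wrap) λ ()) (suc i) (shifted (toℕ i))

    step : ∀ a → (∃ λ D → card D ≤ k × (∀ v → v ≢ a → Near D v)) →
           ∃ λ D → card D ≤ k × (∀ v → v ≢ next a → Near D v)
    step a (D , size , dom) =
        D ∘ prev
      , ≤-trans (≤-reflexive (card-prev D)) size
      , λ v v≢ → near-prev D v (dom (prev v) λ eq → v≢ (trans (sym (next-prev v)) (cong next eq)))

-- Bounds on γ(C_n ⊗_f C_m)

γ≤⌈m/3⌉n : ∀ {n m} → 2 ≤ n → 2 ≤ m → (f : Fin n → Fin m) →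
           γ⊗ f ≤ ⌈ m /3⌉ * n
γ≤⌈m/3⌉n {n} {m} 2≤n 2≤m f = begin
  γ⊗ f
    ≤⟨ γ≤slices f 2≤n 2≤m (λ _ → restart₃ 0 ∘ toℕ) (λ _ h → inj₁ (near-restart₃ 0 h)) ⟩
  sum {n} (λ _ → card {m} (multiple₃ ∘ toℕ))
    ≡⟨ sum-const n _ ⟩
  card {m} (multiple₃ ∘ toℕ) * n
    ≡⟨ cong (_* n) (card-multiple₃ m) ⟩
  ⌈ m /3⌉ * n ∎
  where open ≤-Reasoning

γ≤kn+⌈n/3⌉ : ∀ {n k m} → 2 ≤ n → 2 ≤ suc m → m ≡ 3 * k → (f : Fin n → Fin (suc m)) →
             γ⊗ f ≤ k * n + ⌈ n /3⌉
γ≤kn+⌈n/3⌉ {n} {k} {m} 2≤n 2≤m m≡ f = begin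
  γ⊗ f
    ≤⟨ γ≤slices f 2≤n 2≤m (λ g → proj₁ (slice g)) dom ⟩
  sum (λ g → card (proj₁ (slice g)))
    ≤⟨ sum-mono-≤ (λ g → proj₁ (proj₂ (slice g))) ⟩
  sum (λ g → k + 𝟙 (W g))
    ≡⟨ ∑-distrib-+ (λ _ → k) (𝟙 ∘ W) ⟩
  sum {n} (λ _ → k) + card W
    ≡⟨ cong₂ _+_ (sum-const n k) (card-multiple₃ n) ⟩
  k * n + ⌈ n /3⌉ ∎
  where
  open ≤-Reasoning

  W : Fin n → Bool
  W = restart₃ 0 ∘ toℕ

  -- The last condition refers to `W` and not to neighbouring slices, so the slices can be chosen
  -- independently. The condition on connectors makes them fit together in `dom`.
  Slice : Fin n → Bool → Set
  Slice g w = ∃ λ D → card D ≤ k + 𝟙 w ×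
    (w ≡ true → D (f (next g)) ≡ true × D (f (prev g)) ≡ true) ×
    (∀ h → Near D h ⊎ ∃ λ g′ → Adj (C n) g′ g × W g′ ≡ true × h ≡ f g′)

  slice : ∀ g → Slice g (W g)
  slice g with W g in eq
  ... | true
    with D , size , D₁ , D₂ , near-all ← dominating-through k m≡ (f (next g)) (f (prev g)) =
    D , ≤-trans size (≤-reflexive (+-comm 1 k)) , (λ _ → D₁ , D₂) , λ h → inj₁ (near-all h)
  -- `W` dominates `C n`, so a copy outside `W` has a neighbour in `W`, and the vertex joined to
  -- that neighbour is the one left out.
  ... | false = helper (near-restart₃ 0 g)
    where
    except : ∀ g′ → Adj (C n) g′ g → W g′ ≡ true → Slice g false
    except g′ g′∼g Wg′ with D , size , near-rest ← dominating-except k m≡ (f g′) =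
      D , ≤-trans size (m≤m+n k 0) , (λ ()) , λ h → decide h (h ≟ᶠ f g′)
      where
      decide : ∀ h → Dec (h ≡ f g′) →
        Near D h ⊎ ∃ λ g′ → Adj (C n) g′ g × W g′ ≡ true × h ≡ f g′
      decide h (yes h≡) = inj₂ (g′ , g′∼g , Wg′ , h≡)
      decide h (no h≢)  = inj₁ (near-rest h h≢)

    helper : Near W g → Slice g false
    helper (inj₁ p)        = contradiction (trans (sym eq) p) λ ()
    helper (inj₂ (inj₁ p)) = except (next g) (symm (C n) (adj-next 2≤n g)) p
    helper (inj₂ (inj₂ p)) = except (prev g) (symm (C n) (adj-prev 2≤n g)) p

  dom : ∀ g h → Near (proj₁ (slice g)) h ⊎
        ∃ λ g′ → Adj (C n) g′ g × proj₁ (slice g′) (f g) ≡ true × h ≡ f g′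
  dom g h with proj₂ (proj₂ (proj₂ (slice g))) h
  ... | inj₁ near-h = inj₁ near-h
  ... | inj₂ (g′ , g′∼g , Wg′ , h≡) = inj₂ (g′ , g′∼g , connector , h≡)
    where
    connector : proj₁ (slice g′) (f g) ≡ true
    -- As `g` is `next g′` or `prev g′`, its connector is one of the two vertices that the slice at
    -- `g′` was made to contain.
    connector with D₁ , D₂ ← proj₁ (proj₂ (proj₂ (slice g′))) Wg′ | adj⇒ (symm (C n) g′∼g)
    ... | inj₁ refl = D₁
    ... | inj₂ refl = D₂

-- Each slice dominates the `m` vertices of its copy other than `zero`. This serves both remainders
-- 0 and 2.
cn≤γ : ∀ {n m c} → (∀ x → m ≤ 3 * x → c ≤ x) →
       c * n ≤ γ⊗ {n} {suc m} (λ _ → zero)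
cn≤γ {n} {m} {c} c-least = slices≤γ {n} λ D size _ _ →
  ≤-trans (≤-reflexive (sym (sum-const n c))) (sum-mono-≤ (λ g → c-least (card (D g)) (size g)))

kn+⌈n/3⌉≤γ : ∀ {n k m} → m ≡ 3 * k →
             k * n + ⌈ n /3⌉ ≤ γ⊗ {n} {suc m} (λ _ → zero)
kn+⌈n/3⌉≤γ {n} {k} {m} m≡ = slices≤γ {n} bound
  where
  module _ (D : Fin n → Fin (suc m) → Bool)
           (size : ∀ g → m ≤ 3 * card (D g))
           (size₀ : ∀ g → Near (D g) zero → suc m ≤ 3 * card (D g))
           (at-zero : ∀ g → Near (D g) zero ⊎ ∃ λ g′ → Adj (C n) g′ g × D g′ zero ≡ true) where

    W : Fin n → Bool
    W g = k <ᵇ card (D g)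

    -- Such a slice dominates all 3k + 1 vertices of its copy, and `k` vertices dominate at most 3k.
    W-near : ∀ g → Near (D g) zero → W g ≡ true
    W-near g near₀ = Equivalence.to T-≡ (<⇒<ᵇ
      (*-cancelˡ-< 3 k (card (D g)) (subst (_< 3 * card (D g)) m≡ (size₀ g near₀))))

    W-dominating : ∀ g → Near W g
    W-dominating g with at-zero g
    ... | inj₁ near₀            = inj₁ (W-near g near₀)
    -- The slice at `g′` contains `zero`, hence is near it within its own copy.
    ... | inj₂ (g′ , g′∼g , p)  = near (W-near g′ (inj₁ p)) g′∼g

    n≤3card : n ≤ 3 * card W
    n≤3card = ≤-trans (≤-reflexive (sym (card-univ n)))
      (card-near (λ _ → true) W (λ g _ → W-dominating g))

    slice-size : ∀ g → k + 𝟙 (W g) ≤ card (D g)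
    slice-size g = k+𝟙[k<x]≤x (*-cancelˡ-≤ 3 (subst (_≤ 3 * card (D g)) m≡ (size g)))

    bound : k * n + ⌈ n /3⌉ ≤ sum (card ∘ D)
    bound = begin
      k * n + ⌈ n /3⌉             ≤⟨ +-monoʳ-≤ (k * n) (⌈n/3⌉-least n≤3card) ⟩
      k * n + card W              ≡⟨ cong (_+ card W) (sum-const n k) ⟨
      sum {n} (λ _ → k) + card W  ≡⟨ ∑-distrib-+ (λ _ → k) (𝟙 ∘ W) ⟨
      sum (λ g → k + 𝟙 (W g))     ≤⟨ sum-mono-≤ slice-size ⟩
      sum (card ∘ D)              ∎
      where open ≤-Reasoning

-- The three remainders modulo 3

module _ {n k : ℕ} (3≤n : 3 ≤ n) (1≤k : 1 ≤ k) where

  private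
    2≤n : 2 ≤ n
    2≤n = <⇒≤ 3≤n

    3≤3k : 3 ≤ 3 * k
    3≤3k = *-monoʳ-≤ 3 1≤k

  -- The length is a variable with an equation because `3 * k + 0` does not reduce to a successor,
  -- while the constant map needs a vertex `zero`.
  Γₛ-3k : ∀ {m} → m ≡ 3 * k + 0 → Γₛ[ C n , C m ]≔ (k * n)
  Γₛ-3k {zero}  m≡ = contradiction (trans m≡ (+-identityʳ _)) (<⇒≢ (≤-trans (s≤s z≤n) 3≤3k))
  Γₛ-3k {suc m} m≡ = ((λ _ → zero) , ≤-antisym (upper _) (cn≤γ least-k)) , upper
    where
    upper : ∀ f → γ⊗ f ≤ k * n
    upper f = subst (λ c → γ⊗ f ≤ c * n)
      (trans (trans (cong ⌈_/3⌉ m≡) (⌈3k+p/3⌉ k 0)) (+-identityʳ k))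
      (γ≤⌈m/3⌉n 2≤n (≤-trans (<⇒≤ 3≤3k) (≤-reflexive (sym (trans m≡ (+-identityʳ _))))) f)

    -- Only 3k - 1 vertices must be covered, but rounding up still forces `k` elements.
    least-k : ∀ x → m ≤ 3 * x → k ≤ x
    least-k x m≤ = m<1+n⇒m≤n (*-cancelˡ-< 3 k (suc x) (begin-strict
      3 * k      ≡⟨ trans m≡ (+-identityʳ _) ⟨
      suc m      ≤⟨ s≤s m≤ ⟩
      1 + 3 * x  <⟨ +-monoˡ-< (3 * x) {1} {3} (s≤s (s≤s z≤n)) ⟩
      3 + 3 * x  ≡⟨ *-suc 3 x ⟨
      3 * suc x  ∎))
      where open ≤-Reasoning

  Γₛ-3k+1 : Γₛ[ C n , C (suc (3 * k)) ]≔ (k * n + ⌈ n /3⌉)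
  Γₛ-3k+1 = ((λ _ → zero) , ≤-antisym (upper _) (kn+⌈n/3⌉≤γ {k = k} refl)) , upper
    where
    upper : ∀ f → γ⊗ f ≤ k * n + ⌈ n /3⌉
    upper = γ≤kn+⌈n/3⌉ {k = k} 2≤n (<⇒≤ (m≤n⇒m≤1+n 3≤3k)) refl

  Γₛ-3k+2 : Γₛ[ C n , C (suc (3 * k + 1)) ]≔ ((k + 1) * n)
  Γₛ-3k+2 = ((λ _ → zero) , ≤-antisym (upper _) (cn≤γ least-k+1)) , upper
    where
    upper : ∀ f → γ⊗ f ≤ (k + 1) * n
    upper f = subst (λ c → γ⊗ f ≤ c * n)
      (trans (cong ⌈_/3⌉ (sym (+-suc (3 * k) 1))) (⌈3k+p/3⌉ k 2))
      (γ≤⌈m/3⌉n 2≤n (m≤n⇒m≤1+n (m≤n⇒m≤n+o 1 (<⇒≤ 3≤3k))) f)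

    least-k+1 : ∀ x → 3 * k + 1 ≤ 3 * x → k + 1 ≤ x
    least-k+1 x 3k+1≤ = subst (_≤ x) (+-comm 1 k)
      (*-cancelˡ-< 3 k x (subst (_≤ 3 * x) (+-comm (3 * k) 1) 3k+1≤))

theorem3p2 : (n k p : ℕ) → 3 ≤ n → 1 ≤ k →
    (p ≡ 0 → Γₛ[ C n , C (3 * k + p) ]≔ (k * n)) ×
    (p ≡ 1 → Γₛ[ C n , C (3 * k + p) ]≔ (k * n + ⌈ n /3⌉)) ×
    (p ≡ 2 → Γₛ[ C n , C (3 * k + p) ]≔ ((k + 1) * n))
theorem3p2 n k p 3≤n 1≤k =
    (λ where refl → Γₛ-3k 3≤n 1≤k refl)
  , (λ where refl → subst (λ m → Γₛ[ C n , C m ]≔ (k * n + ⌈ n /3⌉)) (+-comm 1 (3 * k)) (Γₛ-3k+1 3≤n 1≤k))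
  , (λ where refl → subst (λ m → Γₛ[ C n , C m ]≔ ((k + 1) * n)) (sym (+-suc (3 * k) 1)) (Γₛ-3k+2 3≤n 1≤k))
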